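{- For every nonempty signed graph $\Sigma=(G,\sigma)$ with vertex set $V$, the value $\overline{\vartheta}_{\mathrm b}(\Sigma)$ is the optimum of the semidefinite program: minimize $t$ over $t\in\mathbb R$ and real symmetric matrices $X,Y$ indexed by $V$, subject to $$X\succeq0,\quad Y\succeq0,\quad X_{vv}=t-1\ (v\in V),\quad Y_{vv}=t\ (v\in V),\quad X_{uv}-\sigma(uv)Y_{uv}=-1\ (uv\in E(\Sigma)),$$ where the last constraint is imposed for every signed edge (so for both signs when $u,v$ are joined by edges of both signs).
   Context: Signed graphs. A signed graph is a pair $\Sigma=(G,\sigma)$ with $G$ a finite graph and $\sigma:E(G)\to\{+1,-1\}$. Positive loops are allowed, negative loops are excluded; between two distinct vertices there may be both a positive and a negative edge (a digon); repeated edges of the same sign are immaterial. Convention: every signed graph is replaced by its completion having a positive loop at every vertex. Signed homomorphism. A signed homomorphism $\Sigma\to\Pi$ consists of a switching function $\tau:V(\Sigma)\to\{\pm1\}$ and a vertex map $f:V(\Sigma)\to V(\Pi)$ such that for every edge $e=uv$ of $\Sigma$ the signed graph $\Pi$ contains an edge between $f(u)$ and $f(v)$ of sign $\tau(u)\sigma(e)\tau(v)$. Signed sphere. Let $\mathcal H=\mathcal H_+\oplus\mathcal H_-$ be a finite-dimensional real inner-product space (orthogonal direct sum) and $R(a,b)=(a,-b)$. For $t\ge1$ put $\gamma_t=\frac1{1-2t}$. The (infinite) signed graph $\mathcal S_t(\mathcal H,R)$ has vertex set $\{x\in\mathcal H:\|x\|=1,\ \langle x,Rx\rangle=\gamma_t\}$;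 $x,y$ are joined by a negative edge iff $\langle x,y\rangle=\gamma_t$, and by a positive edge iff $\langle x,Ry\rangle=\gamma_t$ (both may hold; $x=y$ allowed). Balanced theta parameter. For nonempty $\Sigma$ (with positive loops adjoined), $\overline{\vartheta}_{\mathrm b}(\Sigma)=\inf\{t\ge1:\text{there is a signed homomorphism }\Sigma\to\mathcal S_t(\mathcal H,R)\text{ for some finite-dimensional }\mathcal H=\mathcal H_+\oplus\mathcal H_-\}$. -}

module Defs where

open import Level using (0ℓ)
open import Algebra.Bundles using (CommutativeMonoid; CommutativeRing)
open import Algebra.Module.Bundles using (Module)
import Algebra.Module.Construct.DirectProduct as DirectProduct
import Algebra.Properties.AbelianGroup as AbelianGroupProperties
import Algebra.Properties.CommutativeMonoid.Sum as Sum
import Algebra.Properties.CommutativeSemigroup as CommutativeSemigroupProperties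
import Algebra.Properties.Ring as RingProperties
open import Data.Fin.Base using (Fin)
open import Data.Nat.Base using (ℕ)
open import Data.Product using (∃; Σ-syntax; ∃-syntax; _×_; _,_)
open import Data.Sign.Base as Sign using (Sign)
open import Data.Sum.Base using (_⊎_; inj₁; inj₂)
open import Relation.Binary.Core using (Rel)
open import Relation.Binary.PropositionalEquality.Core using (_≡_)
import Relation.Binary.PropositionalEquality.Core as ≡
open import Relation.Binary.Structures using (IsTotalOrder)
open import Relation.Nullary using (¬_)

-- The library has no real numbers.  The axioms of a complete ordered field
-- determine them up to isomorphism, and everything below is stated for an
-- arbitrary model ℝ of these axioms.
record CompleteOrderedField : Set₁ where
  infix  4 _≤_
  infix  8 _⁻¹
  field
    commutativeRing : CommutativeRing 0ℓ 0ℓ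

  open CommutativeRing commutativeRing public

  field
    0≉1          : ¬ 0# ≈ 1#
    -- Total function; nothing is assumed about 0# ⁻¹.
    _⁻¹          : Carrier → Carrier
    *-inverseʳ   : ∀ x → ¬ x ≈ 0# → x * x ⁻¹ ≈ 1#
    _≤_          : Rel Carrier 0ℓ
    isTotalOrder : IsTotalOrder _≈_ _≤_
    +-monoˡ-≤    : ∀ z {x y} → x ≤ y → x + z ≤ y + z
    *-nonNeg     : ∀ {x y} → 0# ≤ x → 0# ≤ y → 0# ≤ x * y

  IsUpperBound : (Carrier → Set) → Carrier → Set
  IsUpperBound P b = ∀ x → P x → x ≤ b

  field
    supremum : ∀ (P : Carrier → Set) → ∃ P → ∃ (IsUpperBound P) →
               ∃[ s ] IsUpperBound P s × (∀ b → IsUpperBound P b → s ≤ b)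

  open IsTotalOrder isTotalOrder public
    using (total; antisym; ≤-respˡ-≈; ≤-respʳ-≈)
    renaming (refl to ≤-refl; trans to ≤-trans; reflexive to ≤-reflexive)

-- Edge s u v: u and v are joined by an edge of sign s.  Two vertices may be
-- joined by edges of both signs; multiplicities are not recorded.
record SignedGraph (V : Set) : Set₁ where
  field
    Edge              : Sign → V → V → Set
    Edge-sym          : ∀ {s u v} → Edge s u v → Edge s v u
    no-negative-loops : ∀ {v} → ¬ Edge Sign.- v v

open SignedGraph

completion : ∀ {V} → SignedGraph V → SignedGraph V
completion {V} G = record
  { Edge              = E
  ; Edge-sym          = λ {s} → E-sym s
  ; no-negative-loops = no-negative-loops G
  }
  where
  E : Sign → V → V → Set
  E Sign.+ u v = Edge G Sign.+ u v ⊎ u ≡ v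
  E Sign.- u v = Edge G Sign.- u v

  E-sym : ∀ s {u v} → E s u v → E s v u
  E-sym Sign.+ (inj₁ e) = inj₁ (Edge-sym G e)
  E-sym Sign.+ (inj₂ p) = inj₂ (≡.sym p)
  E-sym Sign.- e        = Edge-sym G e

record SignedHom {V W : Set} (G : SignedGraph V) (H : SignedGraph W) : Set where
  field
    τ         : V → Sign
    f         : V → W
    preserves : ∀ {s u v} → Edge G s u v →
                Edge H (τ u Sign.* s Sign.* τ v) (f u) (f v)

module _ (ℝ : CompleteOrderedField) where
  open CompleteOrderedField ℝ
  open Sum +-commutativeMonoid using (sum)

  IsInfimum : ∀ {ℓ} → (Carrier → Set ℓ) → Carrier → Set ℓ
  IsInfimum P m = (∀ t → P t → m ≤ t) ×
                  (∀ b → (∀ t → P t → b ≤ t) → b ≤ m)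

  IsMinimum : ∀ {ℓ} → (Carrier → Set ℓ) → Carrier → Set ℓ
  IsMinimum P m = P m × (∀ t → P t → m ≤ t)

  ≤-+-right : ∀ {a b} → 0# ≤ b → a ≤ a + b
  ≤-+-right {a} {b} p =
    ≤-respˡ-≈ (+-identityˡ a) (≤-respʳ-≈ (+-comm b a) (+-monoˡ-≤ a p))

  nonNeg-sum-zero : ∀ {a b} → 0# ≤ a → 0# ≤ b → a + b ≈ 0# → a ≈ 0#
  nonNeg-sum-zero pa pb e = antisym (≤-respʳ-≈ e (≤-+-right pb)) pa

  +-nonNeg : ∀ {a b} → 0# ≤ a → 0# ≤ b → 0# ≤ a + b
  +-nonNeg pa pb = ≤-trans pa (≤-+-right pb)

  0≤1 : 0# ≤ 1#
  0≤1 with total 0# 1#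
  ... | inj₁ p = p
  ... | inj₂ p = ≤-respʳ-≈ sq (*-nonNeg q q)
    where
    open RingProperties ring using (-1*x≈-x; -‿involutive)
    q : 0# ≤ - 1#
    q = ≤-respˡ-≈ (-‿inverseʳ 1#) (≤-respʳ-≈ (+-identityˡ (- 1#)) (+-monoˡ-≤ (- 1#) p))
    sq : - 1# * - 1# ≈ 1#
    sq = trans (-1*x≈-x (- 1#)) (-‿involutive 1#)

  record InnerProductSpace : Set₁ where
    field
      vectorSpace : Module commutativeRing 0ℓ 0ℓ

    open Module vectorSpace public
      using (Carrierᴹ; _≈ᴹ_; _+ᴹ_; _*ₗ_; -ᴹ_; 0ᴹ; +ᴹ-commutativeMonoid)

    field
      ⟨_,_⟩      : Carrierᴹ → Carrierᴹ → Carrier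
      ⟨⟩-cong    : ∀ {x x′ y y′} → x ≈ᴹ x′ → y ≈ᴹ y′ → ⟨ x , y ⟩ ≈ ⟨ x′ , y′ ⟩
      ⟨⟩-sym     : ∀ x y → ⟨ x , y ⟩ ≈ ⟨ y , x ⟩
      ⟨⟩-+       : ∀ x y z → ⟨ x +ᴹ y , z ⟩ ≈ ⟨ x , z ⟩ + ⟨ y , z ⟩
      ⟨⟩-*       : ∀ r x y → ⟨ r *ₗ x , y ⟩ ≈ r * ⟨ x , y ⟩
      ⟨⟩-nonNeg  : ∀ x → 0# ≤ ⟨ x , x ⟩
      ⟨⟩-definite : ∀ x → ⟨ x , x ⟩ ≈ 0# → x ≈ᴹ 0ᴹ

    -- ‖ x ‖ = r, i.e. r is the nonnegative square root of ⟨ x , x ⟩.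
    ‖_‖≈_ : Carrierᴹ → Carrier → Set
    ‖ x ‖≈ r = 0# ≤ r × r * r ≈ ⟨ x , x ⟩

    FiniteDimensional : Set
    FiniteDimensional =
      ∃[ d ] Σ[ b ∈ (Fin d → Carrierᴹ) ]
        (∀ x → Σ[ c ∈ (Fin d → Carrier) ]
          x ≈ᴹ Sum.sum +ᴹ-commutativeMonoid (λ i → c i *ₗ b i))

  module _ where
    open InnerProductSpace

    infixr 6 _⊕_

    -- The orthogonal direct sum.
    _⊕_ : InnerProductSpace → InnerProductSpace → InnerProductSpace
    A ⊕ B = record
      { vectorSpace = DirectProduct.⟨module⟩ (vectorSpace A) (vectorSpace B)
      ; ⟨_,_⟩       = λ (a , b) (a′ , b′) → ⟨_,_⟩ A a a′ + ⟨_,_⟩ B b b′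
      ; ⟨⟩-cong     = λ (p , q) (p′ , q′) → +-cong (⟨⟩-cong A p p′) (⟨⟩-cong B q q′)
      ; ⟨⟩-sym      = λ (a , b) (a′ , b′) → +-cong (⟨⟩-sym A a a′) (⟨⟩-sym B b b′)
      ; ⟨⟩-+        = λ (a , b) (a′ , b′) (a″ , b″) →
                        trans (+-cong (⟨⟩-+ A a a′ a″) (⟨⟩-+ B b b′ b″)) (interchange _ _ _ _)
      ; ⟨⟩-*        = λ r (a , b) (a′ , b′) →
                        trans (+-cong (⟨⟩-* A r a a′) (⟨⟩-* B r b b′)) (sym (distribˡ r _ _))
      ; ⟨⟩-nonNeg   = λ (a , b) → +-nonNeg (⟨⟩-nonNeg A a) (⟨⟩-nonNeg B b)
      ; ⟨⟩-definite = λ (a , b) e →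
            ⟨⟩-definite A a (nonNeg-sum-zero (⟨⟩-nonNeg A a) (⟨⟩-nonNeg B b) e)
          , ⟨⟩-definite B b (nonNeg-sum-zero (⟨⟩-nonNeg B b) (⟨⟩-nonNeg A a)
                               (trans (+-comm _ _) e))
      }
      where
      open CommutativeSemigroupProperties
        (CommutativeMonoid.commutativeSemigroup +-commutativeMonoid)
        using (interchange)

    ⟨-,⟩ : ∀ A x y → ⟨_,_⟩ A (-ᴹ_ A x) y ≈ - ⟨_,_⟩ A x y
    ⟨-,⟩ A x y = inverseˡ-unique _ _ (trans (sym (⟨⟩-+ A _ _ _)) (trans
      (⟨⟩-cong A (Module.-ᴹ‿inverseˡ (vectorSpace A) x) (Module.≈ᴹ-refl (vectorSpace A))) zeroˡ′))
      where
      open AbelianGroupProperties +-abelianGroup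
      zeroˡ′ : ⟨_,_⟩ A (0ᴹ A) y ≈ 0#
      zeroˡ′ = identityˡ-unique _ _ (trans (sym (⟨⟩-+ A (0ᴹ A) (0ᴹ A) y))
        (⟨⟩-cong A (Module.+ᴹ-identityˡ (vectorSpace A) (0ᴹ A)) (Module.≈ᴹ-refl (vectorSpace A))))

    ⟨,-⟩ : ∀ A x y → ⟨_,_⟩ A x (-ᴹ_ A y) ≈ - ⟨_,_⟩ A x y
    ⟨,-⟩ A x y = trans (⟨⟩-sym A _ _) (trans (⟨-,⟩ A y x) (-‿cong (⟨⟩-sym A y x)))

    γ : Carrier → Carrier
    γ t = (1# - (1# + 1#) * t) ⁻¹

    γ≉1 : ∀ {t} → 1# ≤ t → ¬ 1# ≈ γ t
    γ≉1 {t} 1≤t 1≈γ = 0≉1 (antisym 0≤1 (≤-trans 1≤2t (≤-reflexive 2t≈0)))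
      where
      open AbelianGroupProperties +-abelianGroup
      2t = (1# + 1#) * t

      t+t≈2t : t + t ≈ 2t
      t+t≈2t = sym (trans (distribʳ t 1# 1#) (+-cong (*-identityˡ t) (*-identityˡ t)))

      2≤2t : 1# + 1# ≤ 2t
      2≤2t = ≤-respʳ-≈ t+t≈2t (≤-trans (+-monoˡ-≤ 1# 1≤t)
        (≤-respˡ-≈ (+-comm 1# t) (+-monoˡ-≤ t 1≤t)))

      1≤2t : 1# ≤ 2t
      1≤2t = ≤-trans (≤-+-right 0≤1) 2≤2t

      1-2t≉0 : ¬ 1# - 2t ≈ 0#
      1-2t≉0 e = 0≉1 (antisym 0≤1
        (≤-respˡ-≈ 2-1≈1 (≤-respʳ-≈ e′ (+-monoˡ-≤ (- 1#) 2≤2t))))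
        where
        1≈2t : 1# ≈ 2t
        1≈2t = x∙y⁻¹≈ε⇒x≈y 1# 2t e
        e′ : 2t - 1# ≈ 0#
        e′ = trans (+-congʳ (sym 1≈2t)) (-‿inverseʳ 1#)
        2-1≈1 : 1# + 1# - 1# ≈ 1#
        2-1≈1 = trans (+-assoc _ _ _) (trans (+-congˡ (-‿inverseʳ 1#)) (+-identityʳ 1#))

      1-2t≈1 : 1# - 2t ≈ 1#
      1-2t≈1 = trans (sym (*-identityʳ _)) (trans (*-congˡ 1≈γ) (*-inverseʳ _ 1-2t≉0))

      2t≈0 : 2t ≈ 0#
      2t≈0 = trans (sym (⁻¹-involutive 2t))
               (trans (-‿cong (identityʳ-unique _ _ 1-2t≈1)) ε⁻¹≈ε)

    module _ (H₊ H₋ : InnerProductSpace) where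
      private
        module H = InnerProductSpace (H₊ ⊕ H₋)

      R : H.Carrierᴹ → H.Carrierᴹ
      R (a , b) = a , -ᴹ_ H₋ b

      SpherePoint : Carrier → Set
      SpherePoint t = Σ[ x ∈ H.Carrierᴹ ] (H.‖ x ‖≈ 1#) × (H.⟨ x , R x ⟩ ≈ γ t)

      SphereEdge : ∀ t → Sign → SpherePoint t → SpherePoint t → Set
      SphereEdge t Sign.- (x , _) (y , _) = H.⟨ x , y ⟩ ≈ γ t
      SphereEdge t Sign.+ (x , _) (y , _) = H.⟨ x , R y ⟩ ≈ γ t

      signedSphere : ∀ t → 1# ≤ t → SignedGraph (SpherePoint t)
      signedSphere t 1≤t = record
        { Edge              = SphereEdge t
        ; Edge-sym          = λ {s} {x} {y} → edge-sym s x y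
        ; no-negative-loops = λ { {x , (_ , 1≈⟨x,x⟩) , _} e →
            γ≉1 1≤t (trans (sym (*-identityˡ 1#)) (trans 1≈⟨x,x⟩ e)) }
        }
        where
        R-selfAdjoint : ∀ x y → H.⟨ x , R y ⟩ ≈ H.⟨ y , R x ⟩
        R-selfAdjoint (a , b) (a′ , b′) = +-cong (⟨⟩-sym H₊ a a′)
          (trans (⟨,-⟩ H₋ b b′) (trans (-‿cong (⟨⟩-sym H₋ b b′)) (sym (⟨,-⟩ H₋ b′ b))))

        edge-sym : ∀ s x y → SphereEdge t s x y → SphereEdge t s y x
        edge-sym Sign.- (x , _) (y , _) e = trans (H.⟨⟩-sym y x) e
        edge-sym Sign.+ (x , _) (y , _) e = trans (R-selfAdjoint y x) e

    SphereColourable : ∀ {V} → SignedGraph V → Carrier → Set₁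
    SphereColourable G t =
      Σ[ 1≤t ∈ 1# ≤ t ] Σ[ H₊ ∈ InnerProductSpace ] Σ[ H₋ ∈ InnerProductSpace ]
        FiniteDimensional H₊ × FiniteDimensional H₋ ×
        SignedHom (completion G) (signedSphere H₊ H₋ t 1≤t)

  -- The parameter as a relation: "the balanced theta parameter of G is θ".
  -- Infima are unique up to _≈_.
  IsBalancedTheta : ∀ {V} → SignedGraph V → Carrier → Set₁
  IsBalancedTheta G θ = IsInfimum (SphereColourable G) θ

  Matrix : ℕ → Set
  Matrix n = Fin n → Fin n → Carrier

  Symmetric : ∀ {n} → Matrix n → Set
  Symmetric M = ∀ u v → M u v ≈ M v u

  PositiveSemidefinite : ∀ {n} → Matrix n → Set
  PositiveSemidefinite {n} M = ∀ (c : Fin n → Carrier) →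
    0# ≤ sum (λ u → sum (λ v → c u * M u v * c v))

  signValue : Sign → Carrier
  signValue Sign.+ = 1#
  signValue Sign.- = - 1#

  record SDPFeasible {n} (G : SignedGraph (Fin n)) (t : Carrier) : Set where
    field
      X Y        : Matrix n
      X-sym      : Symmetric X
      Y-sym      : Symmetric Y
      X-psd      : PositiveSemidefinite X
      Y-psd      : PositiveSemidefinite Y
      X-diagonal : ∀ v → X v v ≈ t - 1#
      Y-diagonal : ∀ v → Y v v ≈ t
      -- For the adjoined positive loops this follows from the two diagonal
      -- constraints.
      edge       : ∀ {s u v} → Edge (completion G) s u v →
                   X u v - signValue s * Y u v ≈ - 1#

  IsSDPOptimum : ∀ {n} → SignedGraph (Fin n) → Carrier → Set
  IsSDPOptimum G θ = IsMinimum (SDPFeasible G) θ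

{-# OPTIONS --safe #-}
-- Scaling by 2t - 1 and absorbing the switching function into Y turns the Gram
-- matrices of the two components of a sphere colouring into a feasible pair (X, Y)
-- for the same t, and back: a positive semidefinite matrix is a Gram matrix in the
-- quotient of the coordinate space by the radical of its form.  So both problems have
-- the same admissible t, and it remains to see that the infimum θ is attained.  Near
-- θ the entries of X and Y are bounded by the 2 × 2 minors, hence cluster, and all
-- constraints are closed.
module Submission where

open import Defs
open import Level using (0ℓ)
open import Axiom.ExcludedMiddle using (ExcludedMiddle)
open import Algebra.Bundles using (CommutativeRing)
open import Algebra.Module.Bundles using (Module)
import Algebra.Properties.AbelianGroup as AbelianGroupProperties
import Algebra.Properties.CommutativeMonoid.Sum as MonoidSum
import Algebra.Properties.Ring as RingProperties
import Algebra.Properties.Semiring.Mult.TCOptimised as Mult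
import Algebra.Properties.Semiring.Sum as Sum
import Algebra.Solver.Ring as RingSolver
open import Algebra.Solver.Ring.AlmostCommutativeRing
  using (fromCommutativeRing; _-Raw-AlmostCommutative⟶_)
open import Data.Fin.Base using (Fin; zero; suc; combine; remQuot)
open import Data.Fin.Properties using (remQuot-combine)
import Data.Integer.Base as ℤ
import Data.Integer.Properties as ℤ
open import Data.Maybe.Base using (map)
open import Data.Nat.Base as ℕ using (ℕ; zero; suc; NonZero)
import Data.Nat.Properties as ℕ
open import Data.Product using (_×_; _,_; proj₁; proj₂; uncurry; ∃; ∃-syntax)
open import Data.Sign.Base as Sign using (Sign)
open import Data.Sum.Base using (inj₁; inj₂)
open import Relation.Binary.Consequences using (dec⇒weaklyDec)
import Relation.Binary.PropositionalEquality.Core as ≡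
open ≡ using (_≡_; _≢_)
open import Relation.Nullary using (¬_; yes; no; contradiction)
open import Relation.Nullary.Decidable using (decidable-stable)

-- The factor 2t - 1 comes from the two sphere equations. For x = (a, b) they read |a|² + |b|² = 1
-- and |a|² - |b|² = -1/(2t - 1), so |a|² and |b|² are t - 1 and t divided by 2t - 1. An edge of
-- sign s prescribes ⟨a, a′⟩ - s⟨b, b′⟩ = -1/(2t - 1): the sign touches only the second component,
-- which is why switching can be moved there. Taking the quotient by the radical replaces a
-- factorisation of the matrix, with its square roots or diagonalisation. Its one nontrivial point
-- is that isotropic vectors of a semidefinite form are radical. `SphereColourable` lies in `Set₁`,
-- while `supremum` accepts predicates in `Set`; so θ is built on the matrix side, as the supremum
-- of the lower bounds of `SDPFeasible`. This takes an explicit feasible value, namely t = n, and a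
-- lower bound, namely 1. Compactness is phrased with filter bases indexed by the positive elements
-- of the field, in place of sequences and subsequences.

-- Integer coefficients have decidable equality, which the solver needs to cancel terms.
module IntegerCoefficients (R : CommutativeRing 0ℓ 0ℓ) where
  open CommutativeRing R
  open RingProperties ring
  open AbelianGroupProperties +-abelianGroup using (⁻¹-∙-comm)
  open Mult semiring using (1+×; ×-homo-+; ×1-homo-*) renaming (_×_ to _·_)

  ⟦_⟧ : ℤ.ℤ → Carrier
  ⟦ ℤ.+ n      ⟧ = n · 1#
  ⟦ ℤ.-[1+ n ] ⟧ = - (suc n · 1#)

  ⊖-homo : ∀ m n → ⟦ m ℤ.⊖ n ⟧ ≈ m · 1# - n · 1#
  ⊖-homo zero    zero    = sym (-‿inverseʳ 0#)
  ⊖-homo (suc m) zero    = sym (trans (+-congˡ -0#≈0#) (+-identityʳ _))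
  ⊖-homo zero    (suc n) = sym (+-identityˡ _)
  ⊖-homo (suc m) (suc n) = trans (reflexive (≡.cong ⟦_⟧ (ℤ.[1+m]⊖[1+n]≡m⊖n m n)))
    (trans (⊖-homo m n) (sym (trans (+-cong (1+× m 1#) (-‿cong (1+× n 1#)))
      (cancel 1# _ _))))
    where
    cancel : ∀ x y z → (x + y) - (x + z) ≈ y - z
    cancel x y z = trans (+-congʳ (+-comm x y)) (trans (+-assoc y x _) (+-congˡ
      (trans (+-congˡ (sym (⁻¹-∙-comm x z))) (trans (sym (+-assoc x _ _))
        (trans (+-congʳ (-‿inverseʳ x)) (+-identityˡ _))))))

  +-homo : ∀ i j → ⟦ i ℤ.+ j ⟧ ≈ ⟦ i ⟧ + ⟦ j ⟧
  +-homo (ℤ.+ m)      (ℤ.+ n)      = ×-homo-+ 1# m n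
  +-homo (ℤ.+ m)      ℤ.-[1+ n ]   = ⊖-homo m (suc n)
  +-homo ℤ.-[1+ m ]   (ℤ.+ n)      = trans (⊖-homo n (suc m)) (+-comm _ _)
  +-homo ℤ.-[1+ m ]   ℤ.-[1+ n ]   = trans
    (-‿cong (trans (reflexive (≡.cong (_· 1#) (≡.sym (ℕ.+-suc (suc m) n))))
      (×-homo-+ 1# (suc m) (suc n)))) (sym (⁻¹-∙-comm _ _))

  +◃-homo : ∀ n → ⟦ Sign.+ ℤ.◃ n ⟧ ≈ n · 1#
  +◃-homo zero    = refl
  +◃-homo (suc n) = refl

  -◃-homo : ∀ n → ⟦ Sign.- ℤ.◃ n ⟧ ≈ - (n · 1#)
  -◃-homo zero    = sym -0#≈0#
  -◃-homo (suc n) = refl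

  *-homo : ∀ i j → ⟦ i ℤ.* j ⟧ ≈ ⟦ i ⟧ * ⟦ j ⟧
  *-homo (ℤ.+ m)    (ℤ.+ n)    = trans (+◃-homo (m ℕ.* n)) (×1-homo-* m n)
  *-homo (ℤ.+ m)    ℤ.-[1+ n ] = trans (-◃-homo (m ℕ.* suc n))
    (trans (-‿cong (×1-homo-* m (suc n))) (-‿distribʳ-* _ _))
  *-homo ℤ.-[1+ m ] (ℤ.+ n)    = trans (-◃-homo (suc m ℕ.* n))
    (trans (-‿cong (×1-homo-* (suc m) n)) (-‿distribˡ-* _ _))
  *-homo ℤ.-[1+ m ] ℤ.-[1+ n ] = trans (+◃-homo (suc m ℕ.* suc n))
    (trans (×1-homo-* (suc m) (suc n)) (sym (-x*-y≈x*y _ _)))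
    where
    -x*-y≈x*y : ∀ x y → - x * - y ≈ x * y
    -x*-y≈x*y x y = trans (sym (-‿distribˡ-* _ _))
      (trans (-‿cong (sym (-‿distribʳ-* _ _))) (-‿involutive _))

  -‿homo : ∀ i → ⟦ ℤ.- i ⟧ ≈ - ⟦ i ⟧
  -‿homo (ℤ.+ zero)  = sym -0#≈0#
  -‿homo (ℤ.+ suc n) = refl
  -‿homo ℤ.-[1+ n ]  = sym (-‿involutive _)

  morphism : ℤ.+-*-rawRing -Raw-AlmostCommutative⟶ fromCommutativeRing R
  morphism = record
    { ⟦_⟧ = ⟦_⟧ ; +-homo = +-homo ; *-homo = *-homo
    ; -‿homo = -‿homo ; 0-homo = refl ; 1-homo = refl }

  open RingSolver ℤ.+-*-rawRing (fromCommutativeRing R) morphism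
    (λ i j → map (λ p → reflexive (≡.cong ⟦_⟧ p)) (dec⇒weaklyDec ℤ._≟_ i j))
    public using (solve; _:=_; _:+_; _:*_; _:-_; :-_; con; Polynomial)

  :1 : ∀ {n} → Polynomial n
  :1 = con ℤ.1ℤ

-- Order, intervals and small errors in an ordered field.

module OrderedField (ℝ : CompleteOrderedField) where
  open CompleteOrderedField ℝ hiding (zero)
  open IntegerCoefficients commutativeRing

  infix 4 _<_

  -- Strictness is the failure of the reverse inequality. Totality recovers `_≤_` from it, and
  -- positivity then directly supplies the nonvanishing that inversion asks for.
  _<_ : Carrier → Carrier → Set
  x < y = ¬ (y ≤ x)

  <⇒≤ : ∀ {x y} → x < y → x ≤ y
  <⇒≤ {x} {y} x<y with total x y
  ... | inj₁ x≤y = x≤y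
  ... | inj₂ y≤x = contradiction y≤x x<y

  x≤y⇒0≤y-x : ∀ {x y} → x ≤ y → 0# ≤ y - x
  x≤y⇒0≤y-x {x} {y} x≤y = ≤-respˡ-≈ (-‿inverseʳ x) (+-monoˡ-≤ (- x) x≤y)

  0≤d⇒x≤y : ∀ {d x y} → 0# ≤ d → d ≈ y - x → x ≤ y
  0≤d⇒x≤y {d} {x} {y} 0≤d d≈y-x = ≤-respˡ-≈ (+-identityˡ x)
    (≤-respʳ-≈ (solve 2 (λ x y → y :- x :+ x := y) refl x y)
      (+-monoˡ-≤ x (≤-respʳ-≈ d≈y-x 0≤d)))

  x≤0⇒0≤-x : ∀ {x} → x ≤ 0# → 0# ≤ - x
  x≤0⇒0≤-x x≤0 = ≤-respʳ-≈ (+-identityˡ _) (x≤y⇒0≤y-x x≤0)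

  0≤-x⇒x≤0 : ∀ {x} → 0# ≤ - x → x ≤ 0#
  0≤-x⇒x≤0 0≤-x = 0≤d⇒x≤y 0≤-x (sym (+-identityˡ _))

  0<1 : 0# < 1#
  0<1 1≤0 = 0≉1 (antisym (0≤1 ℝ) 1≤0)

  0≤x² : ∀ x → 0# ≤ x * x
  0≤x² x with total 0# x
  ... | inj₁ 0≤x = *-nonNeg 0≤x 0≤x
  ... | inj₂ x≤0 = ≤-respʳ-≈ (solve 1 (λ x → (:- x) :* (:- x) := x :* x) refl x)
                     (*-nonNeg (x≤0⇒0≤-x x≤0) (x≤0⇒0≤-x x≤0))

  0<x⇒x*x⁻¹≈1 : ∀ {x} → 0# < x → x * x ⁻¹ ≈ 1#
  0<x⇒x*x⁻¹≈1 0<x = *-inverseʳ _ (λ x≈0 → 0<x (≤-reflexive x≈0))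

  0≤-factorʳ : ∀ {x y} → 0# < x → 0# ≤ x * y → 0# ≤ y
  0≤-factorʳ {x} {y} 0<x 0≤xy with total 0# y
  ... | inj₁ 0≤y = 0≤y
  ... | inj₂ y≤0 = ≤-reflexive (sym y≈0)
    where
    0≤-xy : 0# ≤ - (x * y)
    0≤-xy = ≤-respʳ-≈ (solve 2 (λ x y → x :* (:- y) := :- (x :* y)) refl x y)
      (*-nonNeg (<⇒≤ 0<x) (x≤0⇒0≤-x y≤0))
    xy≈0 : x * y ≈ 0#
    xy≈0 = antisym (0≤-x⇒x≤0 0≤-xy) 0≤xy
    y≈0 : y ≈ 0#
    y≈0 = trans (sym (*-identityˡ y)) (trans (*-congʳ (sym (0<x⇒x*x⁻¹≈1 0<x)))
      (trans (solve 3 (λ x i y → x :* i :* y := i :* (x :* y)) refl x (x ⁻¹) y)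
        (trans (*-congˡ xy≈0) (zeroʳ _))))

  -- Stands in for dividing by two: if x ≤ 0, then x + x ≤ x, so x inherits the bound.
  0≤x+x⇒0≤x : ∀ {x} → 0# ≤ x + x → 0# ≤ x
  0≤x+x⇒0≤x {x} 0≤x+x with total 0# x
  ... | inj₁ 0≤x = 0≤x
  ... | inj₂ x≤0 = ≤-trans 0≤x+x (0≤d⇒x≤y (x≤0⇒0≤-x x≤0)
                     (solve 1 (λ x → :- x := x :- (x :+ x)) refl x))

  x≈y-from-≥ : ∀ {x y} → 0# ≤ x - y → 0# ≤ y - x → x ≈ y
  x≈y-from-≥ 0≤x-y 0≤y-x = antisym (0≤d⇒x≤y 0≤y-x refl) (0≤d⇒x≤y 0≤x-y refl)

  x+x≈y+y⇒x≈y : ∀ {x y} → x + x ≈ y + y → x ≈ y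
  x+x≈y+y⇒x≈y x+x≈y+y = x≈y-from-≥ (half x+x≈y+y) (half (sym x+x≈y+y))
    where
    half : ∀ {x y} → x + x ≈ y + y → 0# ≤ x - y
    half {x} {y} e = 0≤x+x⇒0≤x (≤-reflexive (trans (sym (-‿inverseʳ (x + x)))
      (trans (+-congˡ (-‿cong e))
        (solve 2 (λ x y → x :+ x :- (y :+ y) := x :- y :+ (x :- y)) refl x y))))

  -- |x| ≤ δ
  record Within (δ x : Carrier) : Set where
    constructor _,_
    field
      lower : 0# ≤ δ + x
      upper : 0# ≤ δ - x

  within-mono : ∀ {δ ε x} → δ ≤ ε → Within δ x → Within ε x
  within-mono {δ} {ε} {x} δ≤ε (l , u) =
      ≤-respʳ-≈ (solve 3 (λ d e x → e :- d :+ (d :+ x) := e :+ x) refl δ ε x)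
        (+-nonNeg ℝ (x≤y⇒0≤y-x δ≤ε) l)
    , ≤-respʳ-≈ (solve 3 (λ d e x → e :- d :+ (d :- x) := e :- x) refl δ ε x)
        (+-nonNeg ℝ (x≤y⇒0≤y-x δ≤ε) u)

  within-resp : ∀ {δ ε x y} → δ ≈ ε → x ≈ y → Within δ x → Within ε y
  within-resp δ≈ε x≈y (l , u) =
    ≤-respʳ-≈ (+-cong δ≈ε x≈y) l , ≤-respʳ-≈ (+-cong δ≈ε (-‿cong x≈y)) u

  within-+ : ∀ {δ ε x y} → Within δ x → Within ε y → Within (δ + ε) (x + y)
  within-+ {δ} {ε} {x} {y} (l , u) (l′ , u′) =
      ≤-respʳ-≈ (solve 4 (λ d e x y → d :+ x :+ (e :+ y) := d :+ e :+ (x :+ y)) refl δ ε x y)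
        (+-nonNeg ℝ l l′)
    , ≤-respʳ-≈ (solve 4 (λ d e x y → d :- x :+ (e :- y) := d :+ e :- (x :+ y)) refl δ ε x y)
        (+-nonNeg ℝ u u′)

  within-*-nonNeg : ∀ {c δ x} → 0# ≤ c → Within δ x → Within (c * δ) (c * x)
  within-*-nonNeg {c} {δ} {x} 0≤c (l , u) =
      ≤-respʳ-≈ (distribˡ c δ x) (*-nonNeg 0≤c l)
    , ≤-respʳ-≈ (solve 3 (λ c d x → c :* (d :- x) := c :* d :- c :* x) refl c δ x)
        (*-nonNeg 0≤c u)

  within-neg : ∀ {δ x} → Within δ x → Within δ (- x)
  within-neg {δ} {x} (l , u) =
    u , ≤-respʳ-≈ (solve 2 (λ d x → d :+ x := d :- (:- x)) refl δ x) l

  -- The factor `k` is |c|. It is chosen before `δ` and `x`, so one constant serves a whole limit.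
  within-* : ∀ c → ∃[ k ] (0# ≤ k × (∀ {δ x} → Within δ x → Within (k * δ) (c * x)))
  within-* c with total 0# c
  ... | inj₁ 0≤c = c , 0≤c , within-*-nonNeg 0≤c
  ... | inj₂ c≤0 = - c , x≤0⇒0≤-x c≤0 , λ {δ} {x} w →
    within-resp refl (solve 2 (λ c x → :- ((:- c) :* x) := c :* x) refl c x)
      (within-neg (within-*-nonNeg (x≤0⇒0≤-x c≤0) w))

  -- If x were negative, ε = -x / (K + 1) would be positive with K * ε + x = -ε. Dividing by K + 1
  -- rather than K covers K = 0.
  nonNeg-limit : ∀ {K x} → 0# ≤ K → (∀ ε → 0# < ε → 0# ≤ K * ε + x) → ¬ ¬ (0# ≤ x)
  nonNeg-limit {K} {x} 0≤K h x<0 = 0<ε (0≤-x⇒x≤0 (≤-respʳ-≈ step (h ε 0<ε)))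
    where
    0<K+1 : 0# < K + 1#
    0<K+1 K+1≤0 = 0<1 (≤-trans (≤-+-right ℝ 0≤K) (≤-respˡ-≈ (+-comm K 1#) K+1≤0))
    i = (K + 1#) ⁻¹
    ε = - x * i
    x≈ : (K + 1#) * ε ≈ - x
    x≈ = trans (solve 3 (λ k i x → k :* ((:- x) :* i) := k :* i :* (:- x)) refl (K + 1#) i x)
      (trans (*-congʳ (0<x⇒x*x⁻¹≈1 0<K+1)) (*-identityˡ _))
    0<ε : 0# < ε
    0<ε ε≤0 = x<0 (≤-respʳ-≈ (trans (solve 2 (λ k e → k :* (:- e) := :- (k :* e)) refl (K + 1#) ε)
      (trans (-‿cong x≈) (solve 1 (λ x → :- (:- x) := x) refl x)))
      (*-nonNeg (<⇒≤ 0<K+1) (x≤0⇒0≤-x ε≤0)))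
    step : K * ε + x ≈ - ε
    step = trans (solve 3 (λ k e x → k :* e :+ x := :- e :+ ((k :+ :1) :* e :+ x)) refl K ε x)
      (trans (+-congˡ (trans (+-congʳ x≈) (-‿inverseˡ x))) (+-identityʳ _))

-- Cluster points and limits along filter bases.

module Limits (em : ExcludedMiddle 0ℓ) (ℝ : CompleteOrderedField) where
  open CompleteOrderedField ℝ hiding (zero)
  open IntegerCoefficients commutativeRing
  open OrderedField ℝ
  open Sum semiring using (sum)

  stable : {P : Set} → ¬ ¬ P → P
  stable = decidable-stable em

  ¬∀⇒∃¬ : {A : Set} {P Q : A → Set} → ¬ (∀ x → P x → Q x) → ∃[ x ] P x × ¬ Q x
  ¬∀⇒∃¬ ¬∀ = stable λ ¬∃ → ¬∀ λ x p → stable λ ¬q → ¬∃ (x , p , ¬q)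

  positiveMin : {δ ε : Carrier} → 0# < δ → 0# < ε → ∃[ η ] 0# < η × η ≤ δ × η ≤ ε
  positiveMin {δ} {ε} 0<δ 0<ε with total δ ε
  ... | inj₁ δ≤ε = δ , 0<δ , ≤-refl , δ≤ε
  ... | inj₂ ε≤δ = ε , 0<ε , ε≤δ , ≤-refl

  -- `Near ε` shrinks with ε. Indexing by field elements instead of natural numbers avoids an appeal
  -- to the Archimedean property.
  record FilterBase (A : Set) : Set₁ where
    field
      Near      : Carrier → A → Set
      mono      : ∀ {δ ε x} → δ ≤ ε → Near δ x → Near ε x
      inhabited : ∀ ε → 0# < ε → ∃ (Near ε)

  open FilterBase

  module _ {A : Set} where

    ClusterPoint : FilterBase A → ∀ {m} → (Fin m → A → Carrier) → (Fin m → Carrier) → Set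
    ClusterPoint F f s = ∀ ε → 0# < ε → ∃[ x ] Near F ε x × (∀ i → Within ε (f i x - s i))

    -- The counterpart of passing to a subsequence: along the refined base, the cluster point is a
    -- limit with error at most ε at level ε.
    restrict : ∀ (F : FilterBase A) {m} (f : Fin m → A → Carrier) s →
               ClusterPoint F f s → FilterBase A
    restrict F f s cluster = record
      { Near      = λ ε x → Near F ε x × (∀ i → Within ε (f i x - s i))
      ; mono      = λ δ≤ε (near , w) → mono F δ≤ε near , λ i → within-mono δ≤ε (w i)
      ; inhabited = cluster
      }

    -- The cluster value is the limit inferior.
    clusterValue : (F : FilterBase A) (f : A → Carrier) (B : Carrier) →
      (∀ x → Near F 1# x → Within B (f x)) →
      ∃[ s ] (∀ ε → 0# < ε → ∃[ x ] Near F ε x × Within ε (f x - s))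
    clusterValue F f B bounded = s , near
      where
      Eventually≥ : Carrier → Set
      Eventually≥ y = ∃[ ε ] 0# < ε × (∀ x → Near F ε x → y ≤ f x)

      -B≤f : ∀ x → Near F 1# x → - B ≤ f x
      -B≤f x near = 0≤d⇒x≤y (Within.lower (bounded x near))
        (solve 2 (λ b y → b :+ y := y :- (:- b)) refl B (f x))

      y≤B : ∀ y → Eventually≥ y → y ≤ B
      y≤B y (ε , 0<ε , y≤f) =
        let δ , 0<δ , δ≤ε , δ≤1 = positiveMin 0<ε 0<1
            x , near            = inhabited F δ 0<δ
        in ≤-trans (y≤f x (mono F δ≤ε near))
             (0≤d⇒x≤y (Within.upper (bounded x (mono F δ≤1 near))) refl)

      lub     = supremum Eventually≥ (- B , 1# , 0<1 , -B≤f) (B , y≤B)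
      s       = proj₁ lub
      s-upper = proj₁ (proj₂ lub)
      s-least = proj₂ (proj₂ lub)

      near : ∀ ε → 0# < ε → ∃[ x ] Near F ε x × Within ε (f x - s)
      near ε 0<ε =
        -- `s - ε` does not bound the eventual lower bounds from above, so some `y` among them
        -- exceeds it. And `s + ε` is not itself an eventual lower bound, so points as near as
        -- desired have values below it.
        let y , (δ , 0<δ , y≤f) , s-ε<y = ¬∀⇒∃¬ {Q = λ y → y ≤ s - ε} λ s-ε-upper →
              0<ε (0≤d⇒x≤y (x≤y⇒0≤y-x (s-least (s - ε) s-ε-upper))
                (solve 2 (λ s e → s :- e :- s := con ℤ.0ℤ :- e) refl s ε))
            η , 0<η , η≤δ , η≤ε = positiveMin 0<δ 0<ε
            x , x-near , f<s+ε = ¬∀⇒∃¬ {P = Near F η} {Q = λ x → s + ε ≤ f x} λ s+ε≤f →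
              0<ε (0≤d⇒x≤y (x≤y⇒0≤y-x (s-upper (s + ε) (η , 0<η , s+ε≤f)))
                (solve 2 (λ s e → s :- (s :+ e) := con ℤ.0ℤ :- e) refl s ε))
        in x , mono F η≤ε x-near ,
           ( ≤-respʳ-≈ (solve 3 (λ s e y → y :- (s :- e) := e :+ (y :- s)) refl s ε (f x))
               (x≤y⇒0≤y-x (≤-trans (<⇒≤ s-ε<y) (y≤f x (mono F η≤δ x-near))))
           , ≤-respʳ-≈ (solve 3 (λ s e y → s :+ e :- y := e :- (y :- s)) refl s ε (f x))
               (x≤y⇒0≤y-x (<⇒≤ f<s+ε)) )

    -- Bolzano-Weierstrass one coordinate at a time: each coordinate refines the base before the
    -- next is treated. The bounds survive because refining only shrinks `Near`.
    clusterPoint : (F : FilterBase A) → ∀ {m} (f : Fin m → A → Carrier) (B : Carrier) →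
      (∀ i x → Near F 1# x → Within B (f i x)) → ∃ (ClusterPoint F f)
    clusterPoint F {zero}  f B bounded = (λ ()) , λ ε 0<ε →
      let x , near = inhabited F ε 0<ε in x , near , λ ()
    clusterPoint F {suc m} f B bounded =
      let s , cluster   = clusterValue F (f zero) B (bounded zero)
          F′            = restrict F (λ (_ : Fin 1) → f zero) (λ _ → s) λ ε 0<ε →
                            let x , near , w = cluster ε 0<ε in x , near , λ _ → w
          s′ , cluster′ = clusterPoint F′ (λ i → f (suc i)) B
                            (λ i x near → bounded (suc i) x (proj₁ near))
      in (λ { zero → s ; (suc i) → s′ i }) , λ ε 0<ε →
           let x , (near , w) , w′ = cluster′ ε 0<ε
           in x , near , λ { zero → w zero ; (suc i) → w′ i }

  module Convergence {A : Set} (F : FilterBase A) where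

    infix 4 _⇝_

    -- Convergence at a linear rate: the constant `K` is uniform in ε, so sums and scalar multiples
    -- compose without rescaling ε. This suffices because every constraint is linear in t and the
    -- entries of the matrices.
    _⇝_ : (A → Carrier) → Carrier → Set
    g ⇝ l = ∃[ K ] 0# ≤ K × (∀ ε x → Near F ε x → Within (K * ε) (g x - l))

    ⇝-const : ∀ l → (λ _ → l) ⇝ l
    ⇝-const l = 0# , ≤-refl , λ ε x _ →
        ≤-reflexive (solve 2 (λ e l → con ℤ.0ℤ := con ℤ.0ℤ :* e :+ (l :- l)) refl ε l)
      , ≤-reflexive (solve 2 (λ e l → con ℤ.0ℤ := con ℤ.0ℤ :* e :- (l :- l)) refl ε l)

    ⇝-+ : ∀ {g h l m} → g ⇝ l → h ⇝ m → (λ x → g x + h x) ⇝ l + m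
    ⇝-+ {g} {h} {l} {m} (K , 0≤K , w) (L , 0≤L , w′) = K + L , +-nonNeg ℝ 0≤K 0≤L ,
      λ ε x near → within-resp (sym (distribʳ ε K L))
        (solve 4 (λ g h l m → g :- l :+ (h :- m) := g :+ h :- (l :+ m)) refl (g x) (h x) l m)
        (within-+ (w ε x near) (w′ ε x near))

    ⇝-* : ∀ c {g l} → g ⇝ l → (λ x → c * g x) ⇝ c * l
    ⇝-* c {g} {l} (K , 0≤K , w) = let k , 0≤k , scale = within-* c in
      k * K , *-nonNeg 0≤k 0≤K , λ ε x near → within-resp (sym (*-assoc k K ε))
        (solve 3 (λ c g l → c :* (g :- l) := c :* g :- c :* l) refl c (g x) l)
        (scale (w ε x near))

    ⇝-cong : ∀ {g h l m} → (∀ x → g x ≈ h x) → l ≈ m → g ⇝ l → h ⇝ m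
    ⇝-cong g≈h l≈m (K , 0≤K , w) = K , 0≤K , λ ε x near →
      within-resp refl (+-cong (g≈h x) (-‿cong l≈m)) (w ε x near)

    ⇝-neg : ∀ {g l} → g ⇝ l → (λ x → - g x) ⇝ - l
    ⇝-neg {g} {l} c = ⇝-cong (λ x → -1*x≈-x (g x)) (-1*x≈-x l) (⇝-* (- 1#) c)
      where open RingProperties ring

    ⇝-sum : ∀ {m} {g : Fin m → A → Carrier} {l} → (∀ i → g i ⇝ l i) →
            (λ x → sum (λ i → g i x)) ⇝ sum l
    ⇝-sum {zero}  _ = ⇝-const 0#
    ⇝-sum {suc m} c = ⇝-+ (c zero) (⇝-sum (λ i → c (suc i)))

    ⇝-nonNeg : ∀ {g l} → (∀ x → 0# ≤ g x) → g ⇝ l → 0# ≤ l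
    ⇝-nonNeg {g} {l} 0≤g (K , 0≤K , w) = stable (nonNeg-limit 0≤K λ ε 0<ε →
      let x , near = inhabited F ε 0<ε in
      ≤-respʳ-≈ (solve 3 (λ d g l → g :+ (d :- (g :- l)) := d :+ l) refl (K * ε) (g x) l)
        (+-nonNeg ℝ (0≤g x) (Within.upper (w ε x near))))

    -- Carries equality constraints to the limit, as two inequalities that are each closed.
    ⇝-unique : ∀ {g h l m} → (∀ x → g x ≈ h x) → g ⇝ l → h ⇝ m → l ≈ m
    ⇝-unique g≈h g⇝l h⇝m = x≈y-from-≥
      (⇝-nonNeg (λ x → ≤-reflexive (sym (trans (+-congʳ (g≈h x)) (-‿inverseʳ _))))
        (⇝-+ g⇝l (⇝-neg h⇝m)))
      (⇝-nonNeg (λ x → ≤-reflexive (sym (trans (+-congʳ (sym (g≈h x))) (-‿inverseʳ _))))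
        (⇝-+ h⇝m (⇝-neg g⇝l)))

-- Quadratic forms of symmetric matrices.

module QuadraticForms (ℝ : CompleteOrderedField) where
  open CompleteOrderedField ℝ hiding (zero)
  open IntegerCoefficients commutativeRing
  open OrderedField ℝ
  open Sum semiring

  -- Both the identity matrix and, row by row, the standard basis. The recursion matches that of
  -- `sum`.
  δ : ∀ {n} → Fin n → Fin n → Carrier
  δ zero    zero    = 1#
  δ zero    (suc v) = 0#
  δ (suc u) zero    = 0#
  δ (suc u) (suc v) = δ u v

  sum-zero : ∀ {n} {x : Fin n → Carrier} → (∀ i → x i ≈ 0#) → sum x ≈ 0#
  sum-zero {n} x≈0 = trans (sum-cong-≋ x≈0) (sum-replicate-zero n)

  sum-δ : ∀ {n} (u : Fin n) x → sum (λ v → x v * δ u v) ≈ x u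
  sum-δ zero    x = trans (+-cong (*-identityʳ _) (sum-zero (λ v → zeroʳ (x (suc v)))))
                      (+-identityʳ _)
  sum-δ (suc u) x = trans (+-cong (zeroʳ _) (sum-δ u (λ v → x (suc v)))) (+-identityˡ _)

  δ-sym : ∀ {n} (u v : Fin n) → δ u v ≈ δ v u
  δ-sym zero    zero    = refl
  δ-sym zero    (suc v) = refl
  δ-sym (suc u) zero    = refl
  δ-sym (suc u) (suc v) = δ-sym u v

  sum-nonNeg : ∀ {n} {x : Fin n → Carrier} → (∀ i → 0# ≤ x i) → 0# ≤ sum x
  sum-nonNeg {zero}  0≤x = ≤-refl
  sum-nonNeg {suc n} 0≤x = +-nonNeg ℝ (0≤x zero) (sum-nonNeg (λ i → 0≤x (suc i)))

  module _ {n : ℕ} where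

    infixl 6 _⊞_
    infixl 7 _⊡_

    _⊞_ : (x y : Fin n → Carrier) → Fin n → Carrier
    (x ⊞ y) u = x u + y u

    _⊡_ : Carrier → (Fin n → Carrier) → Fin n → Carrier
    (r ⊡ x) u = r * x u

    form : Matrix ℝ n → (x y : Fin n → Carrier) → Carrier
    form M x y = sum (λ u → sum (λ v → x u * M u v * y v))

    form-cong : ∀ {M N x x′ y y′} → (∀ u v → M u v ≈ N u v) →
                (∀ u → x u ≈ x′ u) → (∀ u → y u ≈ y′ u) → form M x y ≈ form N x′ y′
    form-cong M≈N x≈x′ y≈y′ = sum-cong-≋ λ u → sum-cong-≋ λ v →
      *-cong (*-cong (x≈x′ u) (M≈N u v)) (y≈y′ v)

    form-⊞ : ∀ M x y z → form M (x ⊞ y) z ≈ form M x z + form M y z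
    form-⊞ M x y z = trans
      (sum-cong-≋ λ u → trans
        (sum-cong-≋ λ v → solve 4 (λ x y m z → (x :+ y) :* m :* z := x :* m :* z :+ y :* m :* z)
                            refl (x u) (y u) (M u v) (z v))
        (∑-distrib-+ (λ v → x u * M u v * z v) (λ v → y u * M u v * z v)))
      (∑-distrib-+ (λ u → sum (λ v → x u * M u v * z v)) (λ u → sum (λ v → y u * M u v * z v)))

    sum²-* : ∀ r (A : Matrix ℝ n) →
             sum (λ u → sum (λ v → r * A u v)) ≈ r * sum (λ u → sum (λ v → A u v))
    sum²-* r A = trans (sum-cong-≋ λ u → sym (*-distribˡ-sum r (A u)))
                   (sym (*-distribˡ-sum r (λ u → sum (A u))))

    form-⊡ : ∀ M r x y → form M (r ⊡ x) y ≈ r * form M x y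
    form-⊡ M r x y = trans
      (sum-cong-≋ λ u → sum-cong-≋ λ v →
        solve 4 (λ r x m y → r :* x :* m :* y := r :* (x :* m :* y)) refl r (x u) (M u v) (y v))
      (sum²-* r λ u v → x u * M u v * y v)

    form-scale : ∀ r M x y → form (λ u v → r * M u v) x y ≈ r * form M x y
    form-scale r M x y = trans
      (sum-cong-≋ λ u → sum-cong-≋ λ v →
        solve 4 (λ r x m y → x :* (r :* m) :* y := r :* (x :* m :* y)) refl r (x u) (M u v) (y v))
      (sum²-* r λ u v → x u * M u v * y v)

    form-sym : ∀ {M} → Symmetric ℝ M → ∀ x y → form M x y ≈ form M y x
    form-sym {M} M-sym x y = trans (∑-comm (λ u v → x u * M u v * y v))
      (sum-cong-≋ λ v → sum-cong-≋ λ u → trans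
        (solve 3 (λ x m y → x :* m :* y := y :* m :* x) refl (x u) (M u v) (y v))
        (*-congʳ (*-congˡ (M-sym u v))))

    form-δ : ∀ M u v → form M (δ u) (δ v) ≈ M u v
    form-δ M u v = trans
      (sum-cong-≋ λ u′ → trans (sum-δ v (λ v′ → δ u u′ * M u′ v′)) (*-comm _ _))
      (sum-δ u (λ u′ → M u′ v))

    -- The form restricted to the span of two vectors; this carries both the entry bound and the
    -- Cauchy-Schwarz argument for isotropic vectors.
    form-expand : ∀ {M} → Symmetric ℝ M → ∀ r s x y →
      form M (r ⊡ x ⊞ s ⊡ y) (r ⊡ x ⊞ s ⊡ y) ≈
      r * r * form M x x + (r * s * form M x y + r * s * form M x y) + s * s * form M y y
    form-expand {M} M-sym r s x y = trans (lin z)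
      (trans (+-cong (*-congˡ (trans (form-sym M-sym x z) (lin x)))
                     (*-congˡ (trans (form-sym M-sym y z) (lin y))))
        (trans (+-congʳ (*-congˡ (+-congˡ (*-congˡ (form-sym M-sym y x)))))
          (solve 5 (λ r s a b c → r :* (r :* a :+ s :* b) :+ s :* (r :* b :+ s :* c) :=
             r :* r :* a :+ (r :* s :* b :+ r :* s :* b) :+ s :* s :* c)
             refl r s (form M x x) (form M x y) (form M y y))))
      where
      z = r ⊡ x ⊞ s ⊡ y
      lin : ∀ w → form M z w ≈ r * form M x w + s * form M y w
      lin w = trans (form-⊞ M (r ⊡ x) (s ⊡ y) w) (+-cong (form-⊡ M r x w) (form-⊡ M s y w))

    psd-diagonal : ∀ {M} → PositiveSemidefinite ℝ M → ∀ v → 0# ≤ M v v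
    psd-diagonal {M} M-psd v = ≤-respʳ-≈ (form-δ M v v) (M-psd (δ v))

    scale-psd : ∀ {k M} → 0# ≤ k → PositiveSemidefinite ℝ M →
                PositiveSemidefinite ℝ (λ u v → k * M u v)
    scale-psd {k} {M} 0≤k M-psd c =
      ≤-respʳ-≈ (sym (form-scale k M c c)) (*-nonNeg 0≤k (M-psd c))

    -- With equal diagonal entries the 2 × 2 minor condition becomes linear: the vectors `δ u` ±
    -- `δ v` give 2d ± 2 `M u v` ≥ 0.
    psd-entry-bound : ∀ {M d} → Symmetric ℝ M → PositiveSemidefinite ℝ M →
                      (∀ v → M v v ≈ d) → ∀ u v → Within d (M u v)
    psd-entry-bound {M} {d} M-sym M-psd M-diag u v =
        0≤x+x⇒0≤x (≤-respʳ-≈ (trans (entries 1# 1#)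
          (solve 2 (λ d m → :1 :* :1 :* d :+ (:1 :* :1 :* m :+ :1 :* :1 :* m) :+ :1 :* :1 :* d
                     := d :+ m :+ (d :+ m)) refl d (M u v))) (M-psd _))
      , 0≤x+x⇒0≤x (≤-respʳ-≈ (trans (entries 1# (- 1#))
          (solve 2 (λ d m → :1 :* :1 :* d :+ (:1 :* (:- :1) :* m :+ :1 :* (:- :1) :* m)
                              :+ (:- :1) :* (:- :1) :* d
                     := d :- m :+ (d :- m)) refl d (M u v))) (M-psd _))
      where
      entries : ∀ r s → form M (r ⊡ δ u ⊞ s ⊡ δ v) (r ⊡ δ u ⊞ s ⊡ δ v) ≈
        r * r * d + (r * s * M u v + r * s * M u v) + s * s * d
      entries r s = trans (form-expand M-sym r s (δ u) (δ v))
        (+-cong (+-cong (*-congˡ (trans (form-δ M u u) (M-diag u)))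
                        (+-cong (*-congˡ (form-δ M u v)) (*-congˡ (form-δ M u v))))
                (*-congˡ (trans (form-δ M v v) (M-diag v))))

-- Gram matrices are positive semidefinite.

module GramMatrix (ℝ : CompleteOrderedField) (H : InnerProductSpace ℝ) where
  open CompleteOrderedField ℝ hiding (zero)
  open IntegerCoefficients commutativeRing
  open QuadraticForms ℝ
  open InnerProductSpace H
  open Module vectorSpace using (+ᴹ-identityˡ; ≈ᴹ-refl)
  open Sum semiring using (sum; sum-cong-≋; *-distribˡ-sum)
  module V = MonoidSum +ᴹ-commutativeMonoid

  gram : ∀ {n} → (Fin n → Carrierᴹ) → Matrix ℝ n
  gram a u v = ⟨ a u , a v ⟩

  ⟨⟩-*ʳ : ∀ r x y → ⟨ x , r *ₗ y ⟩ ≈ r * ⟨ x , y ⟩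
  ⟨⟩-*ʳ r x y = trans (⟨⟩-sym x _) (trans (⟨⟩-* r y x) (*-congˡ (⟨⟩-sym y x)))

  ⟨0,⟩ : ∀ y → ⟨ 0ᴹ , y ⟩ ≈ 0#
  ⟨0,⟩ y = identityˡ-unique _ _
    (trans (sym (⟨⟩-+ 0ᴹ 0ᴹ y)) (⟨⟩-cong (+ᴹ-identityˡ 0ᴹ) ≈ᴹ-refl))
    where open AbelianGroupProperties +-abelianGroup

  ⟨∑,⟩ : ∀ {n} (c : Fin n → Carrier) (a : Fin n → Carrierᴹ) y →
         ⟨ V.sum (λ u → c u *ₗ a u) , y ⟩ ≈ sum (λ u → c u * ⟨ a u , y ⟩)
  ⟨∑,⟩ {zero}  c a y = ⟨0,⟩ y
  ⟨∑,⟩ {suc n} c a y = trans (⟨⟩-+ _ _ y)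
    (+-cong (⟨⟩-* (c zero) (a zero) y) (⟨∑,⟩ (λ u → c (suc u)) (λ u → a (suc u)) y))

  form-gram : ∀ {n} (a : Fin n → Carrierᴹ) c →
    let x = V.sum (λ u → c u *ₗ a u) in form (gram a) c c ≈ ⟨ x , x ⟩
  form-gram a c = sym (trans (⟨∑,⟩ c a x) (sum-cong-≋ λ u →
    trans (*-congˡ (trans (⟨⟩-sym (a u) x) (⟨∑,⟩ c a (a u))))
      (trans (*-distribˡ-sum (c u) (λ v → c v * gram a v u)) (sum-cong-≋ λ v →
        trans (*-congˡ (*-congˡ (⟨⟩-sym (a v) (a u))))
          (solve 3 (λ c m d → c :* (d :* m) := c :* m :* d) refl (c u) (gram a u v) (c v))))))
    where x = V.sum (λ u → c u *ₗ a u)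

  gram-sym : ∀ {n} (a : Fin n → Carrierᴹ) → Symmetric ℝ (gram a)
  gram-sym a u v = ⟨⟩-sym (a u) (a v)

  gram-psd : ∀ {n} (a : Fin n → Carrierᴹ) → PositiveSemidefinite ℝ (gram a)
  gram-psd a c = ≤-respʳ-≈ (sym (form-gram a c)) (⟨⟩-nonNeg _)

-- A positive semidefinite matrix as the Gram matrix of a finite-dimensional space.

module GramSpace (em : ExcludedMiddle 0ℓ) (ℝ : CompleteOrderedField) {n : ℕ}
  {M : Matrix ℝ n} (M-sym : Symmetric ℝ M) (M-psd : PositiveSemidefinite ℝ M) where
  open CompleteOrderedField ℝ hiding (zero)
  open IntegerCoefficients commutativeRing
  open OrderedField ℝ
  open QuadraticForms ℝ
  open Sum semiring using (sum)

  Vec : Set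
  Vec = Fin n → Carrier

  infix 4 _∼_

  -- Equality modulo the radical of the form. Used as the equality of the module, it yields the
  -- quotient on the unchanged carrier of coordinate vectors.
  _∼_ : Vec → Vec → Set
  x ∼ y = ∀ z → form M x z ≈ form M y z

  pointwise : ∀ {x y} → (∀ u → x u ≈ y u) → x ∼ y
  pointwise x≈y z = form-cong (λ _ _ → refl) x≈y (λ _ → refl)

  ⊞-cong : ∀ {x x′ y y′} → x ∼ x′ → y ∼ y′ → x ⊞ y ∼ x′ ⊞ y′
  ⊞-cong x∼x′ y∼y′ z = trans (form-⊞ M _ _ z)
    (trans (+-cong (x∼x′ z) (y∼y′ z)) (sym (form-⊞ M _ _ z)))

  ⊡-cong : ∀ {r s x y} → r ≈ s → x ∼ y → r ⊡ x ∼ s ⊡ y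
  ⊡-cong {r} {s} {x} {y} r≈s x∼y z = trans (form-⊡ M r x z)
    (trans (*-cong r≈s (x∼y z)) (sym (form-⊡ M s y z)))

  x²≈0⇒x≈0 : ∀ {x} → x * x ≈ 0# → x ≈ 0#
  x²≈0⇒x≈0 {x} x²≈0 with em {x ≈ 0#}
  ... | yes x≈0 = x≈0
  ... | no  x≉0 = trans (sym (*-identityʳ x)) (trans (*-congˡ (sym (*-inverseʳ x x≉0)))
    (trans (sym (*-assoc x x _)) (trans (*-congʳ x²≈0) (zeroˡ _))))

  -- Evaluate the form at b z - (a + 1) x, where a = ⟨z,z⟩ and b = ⟨z,x⟩.
  isotropic⇒radical : ∀ x → form M x x ≈ 0# → ∀ z → form M x z ≈ 0#
  isotropic⇒radical x ⟨x,x⟩≈0 z = trans (form-sym M-sym x z) (x²≈0⇒x≈0 (antisym b²≤0 (0≤x² b)))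
    where
    a = form M z z
    b = form M z x
    -- With -a in place of -(a + 1) the value would be -a b², which says nothing when a = 0. The
    -- extra 1 contributes -2b².
    r = - (a + 1#)
    value : form M (b ⊡ z ⊞ r ⊡ x) (b ⊡ z ⊞ r ⊡ x) + b * b * a ≈ - (b * b) + - (b * b)
    value = trans (+-congʳ (trans (form-expand M-sym b r z x) (+-congˡ (*-congˡ ⟨x,x⟩≈0))))
      (solve 2 (λ a b → let r = :- (a :+ :1) in
         b :* b :* a :+ (b :* r :* b :+ b :* r :* b) :+ r :* r :* con ℤ.0ℤ :+ b :* b :* a
           := :- (b :* b) :+ (:- (b :* b))) refl a b)
    b²≤0 : b * b ≤ 0#
    b²≤0 = 0≤-x⇒x≤0 (0≤x+x⇒0≤x (≤-respʳ-≈ value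
      (+-nonNeg ℝ (M-psd (b ⊡ z ⊞ r ⊡ x)) (*-nonNeg (0≤x² b) (M-psd z)))))

  vectorSpace : Module commutativeRing 0ℓ 0ℓ
  vectorSpace = record
    { Carrierᴹ = Vec
    ; _≈ᴹ_     = _∼_
    ; _+ᴹ_     = _⊞_
    ; _*ₗ_     = _⊡_
    ; _*ᵣ_     = λ x r → r ⊡ x
    ; 0ᴹ       = λ _ → 0#
    ; -ᴹ_      = λ x u → - x u
    ; isModule = record
      { isBimodule = record
        { isBisemimodule = record
          { +ᴹ-isCommutativeMonoid = record
            { isMonoid = record
              { isSemigroup = record
                { isMagma = record
                  { isEquivalence = record
                    { refl  = λ z → refl
                    ; sym   = λ x∼y z → sym (x∼y z)
                    ; trans = λ x∼y y∼w z → trans (x∼y z) (y∼w z)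
                    }
                  ; ∙-cong = ⊞-cong
                  }
                ; assoc = λ x y z → pointwise λ u → +-assoc (x u) (y u) (z u)
                }
              ; identity = (λ x → pointwise λ u → +-identityˡ (x u))
                         , (λ x → pointwise λ u → +-identityʳ (x u))
              }
            ; comm = λ x y → pointwise λ u → +-comm (x u) (y u)
            }
          ; isPreleftSemimodule = record
            { *ₗ-cong      = ⊡-cong
            ; *ₗ-zeroˡ     = λ x → pointwise λ u → zeroˡ (x u)
            ; *ₗ-distribʳ  = λ x r s → pointwise λ u → distribʳ (x u) r s
            ; *ₗ-identityˡ = λ x → pointwise λ u → *-identityˡ (x u)
            ; *ₗ-assoc     = λ r s x → pointwise λ u → *-assoc r s (x u)
            ; *ₗ-zeroʳ     = λ r → pointwise λ u → zeroʳ r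
            ; *ₗ-distribˡ  = λ r x y → pointwise λ u → distribˡ r (x u) (y u)
            }
          ; isPrerightSemimodule = record
            { *ᵣ-cong      = λ x∼y r≈s → ⊡-cong r≈s x∼y
            ; *ᵣ-zeroʳ     = λ x → pointwise λ u → zeroˡ (x u)
            ; *ᵣ-distribˡ  = λ x r s → pointwise λ u → distribʳ (x u) r s
            ; *ᵣ-identityʳ = λ x → pointwise λ u → *-identityˡ (x u)
            ; *ᵣ-assoc     = λ x r s → pointwise λ u →
                solve 3 (λ x r s → s :* (r :* x) := r :* s :* x) refl (x u) r s
            ; *ᵣ-zeroˡ     = λ r → pointwise λ u → zeroʳ r
            ; *ᵣ-distribʳ  = λ r x y → pointwise λ u → distribˡ r (x u) (y u)
            }
          ; *ₗ-*ᵣ-assoc = λ r x s → pointwise λ u →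
              solve 3 (λ x r s → s :* (r :* x) := r :* (s :* x)) refl (x u) r s
          }
        ; -ᴹ‿cong = λ {x} {y} x∼y → λ z → trans (neg x z)
            (trans (⊡-cong {x = x} {y = y} refl x∼y z) (sym (neg y z)))
        ; -ᴹ‿inverse = (λ x → pointwise λ u → -‿inverseˡ (x u))
                     , (λ x → pointwise λ u → -‿inverseʳ (x u))
        }
      ; *ₗ-*ᵣ-coincident = λ r x → λ z → refl
      }
    }
    where
    neg : ∀ x → (λ u → - x u) ∼ - 1# ⊡ x
    neg x = pointwise λ u → solve 1 (λ x → :- x := :- :1 :* x) refl (x u)

  space : InnerProductSpace ℝ
  space = record
    { vectorSpace = vectorSpace
    ; ⟨_,_⟩       = form M
    ; ⟨⟩-cong     = λ {x} {x′} {y} {y′} x∼x′ y∼y′ → trans (x∼x′ y)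
        (trans (form-sym M-sym x′ y) (trans (y∼y′ x′) (form-sym M-sym y′ x′)))
    ; ⟨⟩-sym      = form-sym M-sym
    ; ⟨⟩-+        = form-⊞ M
    ; ⟨⟩-*        = form-⊡ M
    ; ⟨⟩-nonNeg   = M-psd
    ; ⟨⟩-definite = λ x ⟨x,x⟩≈0 z → trans (isotropic⇒radical x ⟨x,x⟩≈0 z)
        (sym (trans (pointwise (λ u → sym (zeroˡ 0#)) z) (trans (form-⊡ M 0# _ z) (zeroˡ _))))
    }

  -- The classes of the standard basis vectors span; a degenerate form may make them dependent,
  -- which a spanning family allows.
  finiteDimensional : InnerProductSpace.FiniteDimensional space
  finiteDimensional = n , δ , λ x → x , pointwise λ v → sym (trans (sum-at (λ u → x u ⊡ δ u) v)
    (trans (Sum.sum-cong-≋ semiring λ u → *-congˡ (δ-sym u v)) (sum-δ v x)))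
    where
    module V = MonoidSum (Module.+ᴹ-commutativeMonoid vectorSpace)
    sum-at : ∀ {m} (f : Fin m → Vec) v → V.sum f v ≈ sum (λ i → f i v)
    sum-at {zero}  f v = refl
    sum-at {suc m} f v = +-congˡ (sum-at (λ i → f (suc i)) v)

-- An explicit feasible point at t = n.

module FeasiblePoint (ℝ : CompleteOrderedField) {n : ℕ} (G : SignedGraph (Fin n)) where
  open CompleteOrderedField ℝ hiding (zero)
  open IntegerCoefficients commutativeRing
  open OrderedField ℝ
  open QuadraticForms ℝ
  open Sum semiring
  open SignedGraph

  -- The number of vertices as a field element. At this value N I - J, the Laplacian of the complete
  -- graph, has diagonal t - 1 and is positive semidefinite.
  N : Carrier
  N = sum {n} (λ _ → 1#)

  0≤N : 0# ≤ N
  0≤N = sum-nonNeg {n} (λ _ → 0≤1 ℝ)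

  -- Off the diagonal X₀ is -1 and Y₀ is 0, which suits edges of both signs.
  X₀ Y₀ : Matrix ℝ n
  X₀ u v = N * δ u v - 1#
  Y₀ u v = N * δ u v

  -- Three summands are what the double sum of (c u - c v)² needs at each level; shorter expressions
  -- are padded with coefficient zero.
  sum-linear : ∀ {m} p q r (x y z : Fin m → Carrier) →
    sum (λ v → p * x v + (q * y v + r * z v)) ≈ p * sum x + (q * sum y + r * sum z)
  sum-linear p q r x y z = trans (∑-distrib-+ (λ v → p * x v) (λ v → q * y v + r * z v))
    (+-cong (sym (*-distribˡ-sum p x))
      (trans (∑-distrib-+ (λ v → q * y v) (λ v → r * z v))
        (+-cong (sym (*-distribˡ-sum q y)) (sym (*-distribˡ-sum r z)))))

  module _ (c : Fin n → Carrier) where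
    S Q : Carrier
    S = sum c
    Q = sum (λ u → c u * c u)

    form-Y₀ : form Y₀ c c ≈ sum (λ u → N * (c u * c u))
    form-Y₀ = sum-cong-≋ λ u → trans
      (sum-cong-≋ λ v → solve 4 (λ c n d c′ → c :* (n :* d) :* c′ := n :* (c :* c′) :* d)
                          refl (c u) N (δ u v) (c v))
      (sum-δ u (λ v → N * (c u * c v)))

    form-X₀ : form X₀ c c ≈ N * Q - S * S
    form-X₀ = trans
      (sum-cong-≋ λ u → trans
        (sum-cong-≋ λ v → solve 4 (λ c n d c′ → c :* (n :* d :- :1) :* c′ :=
            n :* (c :* c′ :* d) :+ ((:- c) :* c′ :+ con ℤ.0ℤ :* c′)) refl (c u) N (δ u v) (c v))
        (trans (sum-linear N (- c u) 0# (λ v → c u * c v * δ u v) c c)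
          (trans (+-congʳ (*-congˡ (sum-δ u (λ v → c u * c v))))
            (solve 3 (λ n c s → n :* (c :* c) :+ ((:- c) :* s :+ con ℤ.0ℤ :* s) :=
               n :* (c :* c) :+ ((:- s) :* c :+ con ℤ.0ℤ :* c)) refl N (c u) S))))
      (trans (sum-linear N (- S) 0# (λ u → c u * c u) c c)
        (solve 3 (λ n q s → n :* q :+ ((:- s) :* s :+ con ℤ.0ℤ :* s) := n :* q :- s :* s) refl N Q S))

    -- Lagrange's identity: twice the form of `X₀` is a sum of squares.
    squares : sum {n} (λ u → sum {n} (λ v → (c u - c v) * (c u - c v))) ≈
              (N * Q - S * S) + (N * Q - S * S)
    squares = trans
      (sum-cong-≋ λ u → trans
        (sum-cong-≋ λ v → solve 2 (λ c d → (c :- d) :* (c :- d) :=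
            c :* c :* :1 :+ ((:- (c :+ c)) :* d :+ :1 :* (d :* d))) refl (c u) (c v))
        (trans (sum-linear (c u * c u) (- (c u + c u)) 1# (λ _ → 1#) c (λ v → c v * c v))
          (solve 4 (λ c n s q → c :* c :* n :+ ((:- (c :+ c)) :* s :+ :1 :* q) :=
             n :* (c :* c) :+ ((:- (s :+ s)) :* c :+ q :* :1)) refl (c u) N S Q)))
      (trans (sum-linear N (- (S + S)) Q (λ u → c u * c u) c (λ _ → 1#))
        (solve 3 (λ n s q → n :* q :+ ((:- (s :+ s)) :* s :+ q :* n) :=
           (n :* q :- s :* s) :+ (n :* q :- s :* s)) refl N S Q))

  δ-diagonal : ∀ {m} (v : Fin m) → δ v v ≈ 1#
  δ-diagonal zero    = refl
  δ-diagonal (suc v) = δ-diagonal v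

  δ-offDiagonal : ∀ {m} {u v : Fin m} → u ≢ v → δ u v ≈ 0#
  δ-offDiagonal {u = zero}  {zero}  u≢v = contradiction ≡.refl u≢v
  δ-offDiagonal {u = zero}  {suc v} u≢v = refl
  δ-offDiagonal {u = suc u} {zero}  u≢v = refl
  δ-offDiagonal {u = suc u} {suc v} u≢v = δ-offDiagonal (λ u≡v → u≢v (≡.cong suc u≡v))

  feasible : SDPFeasible ℝ G N
  feasible = record
    { X          = X₀
    ; Y          = Y₀
    ; X-sym      = λ u v → +-congʳ (*-congˡ (δ-sym u v))
    ; Y-sym      = λ u v → *-congˡ (δ-sym u v)
    ; X-psd      = λ c → 0≤x+x⇒0≤x (≤-respʳ-≈
        (trans (squares c) (sym (+-cong (form-X₀ c) (form-X₀ c))))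
        (sum-nonNeg λ u → sum-nonNeg λ v → 0≤x² (c u - c v)))
    ; Y-psd      = λ c → ≤-respʳ-≈ (sym (form-Y₀ c))
        (sum-nonNeg λ u → *-nonNeg 0≤N (0≤x² (c u)))
    ; X-diagonal = λ v → +-congʳ (trans (*-congˡ (δ-diagonal v)) (*-identityʳ N))
    ; Y-diagonal = λ v → trans (*-congˡ (δ-diagonal v)) (*-identityʳ N)
    ; edge       = λ {s} → edge s
    }
    where
    edge : ∀ s {u v} → Edge (completion G) s u v → X₀ u v - signValue ℝ s * Y₀ u v ≈ - 1#
    edge Sign.+ {u} {v} _ = solve 2 (λ n d → n :* d :- :1 :- :1 :* (n :* d) := :- :1) refl N (δ u v)
    -- The negative constraint reads X + Y = -1 and holds only off the diagonal; the exclusion of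
    -- negative loops provides u ≠ v.
    edge Sign.- {u} {v} e = trans (+-cong (+-congʳ Nδ≈0) (-‿cong (*-congˡ Nδ≈0)))
      (solve 0 (con ℤ.0ℤ :- :1 :- (:- :1) :* con ℤ.0ℤ := :- :1) refl)
      where
      Nδ≈0 : N * δ u v ≈ 0#
      Nδ≈0 = trans (*-congˡ (δ-offDiagonal {u = u} {v} λ { ≡.refl → no-negative-loops G e })) (zeroʳ N)

-- Sphere colourings and feasible pairs at the same t.

module SphereCorrespondence (em : ExcludedMiddle 0ℓ) (ℝ : CompleteOrderedField) where
  open CompleteOrderedField ℝ hiding (zero)
  open IntegerCoefficients commutativeRing
  open OrderedField ℝ
  open QuadraticForms ℝ
  open SignedGraph

  sv : Sign → Carrier
  sv = signValue ℝ

  sv-* : ∀ s t → sv (s Sign.* t) ≈ sv s * sv t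
  sv-* Sign.+ t      = sym (*-identityˡ _)
  sv-* Sign.- Sign.+ = sym (*-identityʳ _)
  sv-* Sign.- Sign.- = solve 0 (:1 := (:- :1) :* (:- :1)) refl

  sv² : ∀ s → sv s * sv s ≈ 1#
  sv² Sign.+ = *-identityˡ 1#
  sv² Sign.- = solve 0 ((:- :1) :* (:- :1) := :1) refl

  module Scale {t : Carrier} (1≤t : 1# ≤ t) where
    -- γ t = - κ⁻¹
    κ : Carrier
    κ = (1# + 1#) * t - 1#

    0<κ : 0# < κ
    0<κ κ≤0 = 0<1 (≤-trans (0≤d⇒x≤y (+-nonNeg ℝ 0≤t-1 0≤t-1)
      (solve 1 (λ t → (t :- :1) :+ (t :- :1) := (:1 :+ :1) :* t :- :1 :- :1) refl t)) κ≤0)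
      where 0≤t-1 = x≤y⇒0≤y-x 1≤t

    κγ≈-1 : κ * γ ℝ t ≈ - 1#
    κγ≈-1 = trans (solve 2 (λ t g → ((:1 :+ :1) :* t :- :1) :* g :=
                                    :- ((:1 :- (:1 :+ :1) :* t) :* g)) refl t (γ ℝ t))
      (-‿cong (*-inverseʳ _ 1-2t≉0))
      where
      1-2t≉0 : ¬ (1# - (1# + 1#) * t ≈ 0#)
      1-2t≉0 e = 0<κ (≤-reflexive (trans (solve 1 (λ t → (:1 :+ :1) :* t :- :1 :=
        :- (:1 :- (:1 :+ :1) :* t)) refl t) (trans (-‿cong e)
          (solve 0 (:- con ℤ.0ℤ := con ℤ.0ℤ) refl))))

    -- -γ is the factor that shrinks a feasible pair to Gram matrices of unit vectors, so it has to
    -- preserve semidefiniteness.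
    0≤-γ : 0# ≤ - γ ℝ t
    0≤-γ = 0≤-factorʳ 0<κ (≤-respʳ-≈ (trans (solve 0 (:1 := :- (:- :1)) refl)
      (trans (-‿cong (sym κγ≈-1))
        (solve 2 (λ k g → :- (k :* g) := k :* (:- g)) refl κ (γ ℝ t)))) (0≤1 ℝ))

  module _ (H₊ H₋ : InnerProductSpace ℝ) where
    private
      module P = InnerProductSpace H₊
      module M = InnerProductSpace H₋

    -- Both kinds of adjacency in the single shape of the matrix constraint: ⟨x, y⟩ adds the second
    -- components, ⟨x, Ry⟩ subtracts them, and `sv s` records which.
    sphereEdge⇒ : ∀ {t} s {x y : SpherePoint ℝ H₊ H₋ t} → SphereEdge ℝ H₊ H₋ t s x y →
      let (a , b) , _ = x ; (a′ , b′) , _ = y in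
      P.⟨ a , a′ ⟩ - sv s * M.⟨ b , b′ ⟩ ≈ γ ℝ t
    sphereEdge⇒ Sign.+ {(a , b) , _} {(a′ , b′) , _} e =
      trans (+-congˡ (trans (-‿cong (*-identityˡ _)) (sym (⟨,-⟩ ℝ H₋ b b′)))) e
    sphereEdge⇒ Sign.- {(a , b) , _} {(a′ , b′) , _} e =
      trans (solve 2 (λ p m → p :- (:- :1) :* m := p :+ m) refl _ _) e

    sphereEdge⇐ : ∀ {t} s {x y : SpherePoint ℝ H₊ H₋ t} →
      let (a , b) , _ = x ; (a′ , b′) , _ = y in
      P.⟨ a , a′ ⟩ - sv s * M.⟨ b , b′ ⟩ ≈ γ ℝ t → SphereEdge ℝ H₊ H₋ t s x y
    sphereEdge⇐ Sign.+ {(a , b) , _} {(a′ , b′) , _} e =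
      trans (+-congˡ (trans (⟨,-⟩ ℝ H₋ b b′) (-‿cong (sym (*-identityˡ _))))) e
    sphereEdge⇐ Sign.- {(a , b) , _} {(a′ , b′) , _} e =
      trans (solve 2 (λ p m → p :+ m := p :- (:- :1) :* m) refl _ _) e

  module _ {n : ℕ} (G : SignedGraph (Fin n)) where

    colourable⇒feasible : ∀ {t} → SphereColourable ℝ G t → SDPFeasible ℝ G t
    colourable⇒feasible {t} (1≤t , H₊ , H₋ , _ , _ , hom) = record
      { X          = λ u v → κ * P.gram a u v
      ; Y          = λ u v → κ * M.gram b u v
      ; X-sym      = λ u v → *-congˡ (P.gram-sym a u v)
      ; Y-sym      = λ u v → *-congˡ (M.gram-sym b u v)
      ; X-psd      = scale-psd (<⇒≤ 0<κ) (P.gram-psd a)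
      ; Y-psd      = scale-psd (<⇒≤ 0<κ) (M.gram-psd b)
      -- With p = |a|² and m = |b|², the norm gives κ(p + m) = κ and the loop gives κ(p - m) = -1.
      -- Adding yields 2κp = κ - 1 = 2(t - 1); subtracting, for Y, yields 2κm = κ + 1 = 2t.
      ; X-diagonal = λ v → x+x≈y+y⇒x≈y (trans
          (solve 3 (λ k p m → k :* p :+ k :* p := k :* (p :+ m) :+ k :* (p :- m))
            refl κ (P.gram a v v) (M.gram b v v))
          (trans (+-cong (trans (*-congˡ (norm v)) (*-identityʳ κ))
                         (trans (*-congˡ (loop v)) κγ≈-1))
            (solve 1 (λ t → (:1 :+ :1) :* t :- :1 :+ (:- :1) := t :- :1 :+ (t :- :1)) refl t)))
      ; Y-diagonal = λ v → x+x≈y+y⇒x≈y (trans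
          (solve 3 (λ k p m → k :* m :+ k :* m := k :* (p :+ m) :- k :* (p :- m))
            refl κ (P.gram a v v) (M.gram b v v))
          (trans (+-cong (trans (*-congˡ (norm v)) (*-identityʳ κ))
                         (-‿cong (trans (*-congˡ (loop v)) κγ≈-1)))
            (solve 1 (λ t → (:1 :+ :1) :* t :- :1 :- (:- :1) := t :+ t) refl t)))
      ; edge       = λ {s} {u} {v} e → trans
          (solve 4 (λ k s p m → k :* p :- s :* (k :* m) := k :* (p :- s :* m))
            refl κ (sv s) (P.gram a u v) (M.gram b u v))
          (trans (*-congˡ (gram-edge s u v (preserves e))) κγ≈-1)
      }
      where
      open SignedHom hom
      open Scale 1≤t
      module H₊ = InnerProductSpace H₊
      module H₋ = InnerProductSpace H₋
      module P = GramMatrix ℝ H₊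
      module M = GramMatrix ℝ H₋

      a : Fin n → H₊.Carrierᴹ
      a v = proj₁ (proj₁ (f v))

      b′ b : Fin n → H₋.Carrierᴹ
      b′ v = proj₂ (proj₁ (f v))
      -- Multiplying the second component by ±1 keeps its length and turns the prescribed sign τ u ·
      -- s · τ v back into s.
      b  v = sv (τ v) H₋.*ₗ b′ v

      gram-b : ∀ u v → M.gram b u v ≈ sv (τ u) * (sv (τ v) * M.gram b′ u v)
      gram-b u v = trans (H₋.⟨⟩-* (sv (τ u)) (b′ u) (b v))
                     (*-congˡ (M.⟨⟩-*ʳ (sv (τ v)) (b′ u) (b′ v)))

      gram-b-diagonal : ∀ v → M.gram b v v ≈ M.gram b′ v v
      gram-b-diagonal v = trans (gram-b v v)
        (trans (sym (*-assoc _ _ _)) (trans (*-congʳ (sv² (τ v))) (*-identityˡ _)))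

      norm : ∀ v → P.gram a v v + M.gram b v v ≈ 1#
      norm v = trans (+-congˡ (gram-b-diagonal v))
        (trans (sym (proj₂ (proj₁ (proj₂ (f v))))) (*-identityˡ 1#))

      loop : ∀ v → P.gram a v v - M.gram b v v ≈ γ ℝ t
      loop v = trans (+-congˡ (trans (-‿cong (gram-b-diagonal v))
        (sym (⟨,-⟩ ℝ H₋ (b′ v) (b′ v))))) (proj₂ (proj₂ (f v)))

      gram-edge : ∀ s u v → SphereEdge ℝ H₊ H₋ t (τ u Sign.* s Sign.* τ v) (f u) (f v) →
                  P.gram a u v - sv s * M.gram b u v ≈ γ ℝ t
      gram-edge s u v e = trans (+-congˡ (-‿cong (trans (*-congˡ (gram-b u v))
        (trans (solve 4 (λ s x y m → s :* (x :* (y :* m)) := x :* s :* y :* m)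
                 refl (sv s) (sv (τ u)) (sv (τ v)) (M.gram b′ u v))
          (*-congʳ (sym (trans (sv-* (τ u Sign.* s) (τ v)) (*-congʳ (sv-* (τ u) s)))))))))
        (sphereEdge⇒ H₊ H₋ (τ u Sign.* s Sign.* τ v) {f u} {f v} e)

    -- The diagonal entry t - 1 of X at any vertex is nonnegative; nonemptiness supplies the vertex.
    -- The helper `go` quantifies over `n` again so that it can be matched as a successor.
    feasible⇒1≤t : .{{_ : NonZero n}} → ∀ {t} → SDPFeasible ℝ G t → 1# ≤ t
    feasible⇒1≤t = go G
      where
      go : ∀ {n} .{{_ : NonZero n}} (G : SignedGraph (Fin n)) {t} →
           SDPFeasible ℝ G t → 1# ≤ t
      go {suc n} G F = 0≤d⇒x≤y (psd-diagonal {M = X} X-psd zero) (X-diagonal zero)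
        where open SDPFeasible F

    feasible⇒colourable : .{{_ : NonZero n}} → ∀ {t} → SDPFeasible ℝ G t → SphereColourable ℝ G t
    feasible⇒colourable {t} F =
      1≤t , P.space , M.space , P.finiteDimensional , M.finiteDimensional , record
        { τ         = λ _ → Sign.+
        ; f         = point
        -- With constant switching, the left factor `Sign.+` computes away, but the right one is
        -- stuck on the variable `s`; `sv-+` removes it.
        ; preserves = λ {s} {u} {v} e → sphereEdge⇐ P.space M.space (s Sign.* Sign.+) {point u} {point v}
            (edge-value s u v e)
        }
      where
      open SDPFeasible F
      1≤t : 1# ≤ t
      1≤t = feasible⇒1≤t F
      open Scale 1≤t
      k = - γ ℝ t
      module P = GramSpace em ℝ {M = λ u v → k * X u v}
        (λ u v → *-congˡ (X-sym u v)) (scale-psd 0≤-γ X-psd)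
      module M = GramSpace em ℝ {M = λ u v → k * Y u v}
        (λ u v → *-congˡ (Y-sym u v)) (scale-psd 0≤-γ Y-psd)

      p-entry : ∀ u v → InnerProductSpace.⟨_,_⟩ P.space (δ u) (δ v) ≈ k * X u v
      p-entry = form-δ (λ u v → k * X u v)

      m-entry : ∀ u v → InnerProductSpace.⟨_,_⟩ M.space (δ u) (δ v) ≈ k * Y u v
      m-entry = form-δ (λ u v → k * Y u v)

      point : Fin n → SpherePoint ℝ P.space M.space t
      -- The classes of `δ v` have k X and k Y as Gram matrices. Since k(2t - 1) = 1, the squared
      -- norm is k(t - 1) + kt = 1, and the loop value is k(t - 1) - kt = -k = γ.
      point v = (δ v , δ v) , (0≤1 ℝ , norm) , loop
        where
        norm = sym (trans
          (+-cong (trans (p-entry v v) (*-congˡ (X-diagonal v)))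
                  (trans (m-entry v v) (*-congˡ (Y-diagonal v))))
          (trans (solve 2 (λ g t → (:- g) :* (t :- :1) :+ (:- g) :* t :=
                                   :- (((:1 :+ :1) :* t :- :1) :* g)) refl (γ ℝ t) t)
            (trans (-‿cong κγ≈-1) (solve 0 (:- (:- :1) := :1 :* :1) refl))))
        loop = trans
          (+-cong (trans (p-entry v v) (*-congˡ (X-diagonal v)))
                  (trans (⟨,-⟩ ℝ M.space (δ v) (δ v))
                    (-‿cong (trans (m-entry v v) (*-congˡ (Y-diagonal v))))))
          (solve 2 (λ g t → (:- g) :* (t :- :1) :- (:- g) :* t := g) refl (γ ℝ t) t)

      sv-+ : ∀ s → sv (s Sign.* Sign.+) ≈ sv s
      sv-+ s = trans (sv-* s Sign.+) (*-identityʳ _)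

      edge-value : ∀ s u v → Edge (completion G) s u v →
        InnerProductSpace.⟨_,_⟩ P.space (δ u) (δ v) -
          sv (s Sign.* Sign.+) * InnerProductSpace.⟨_,_⟩ M.space (δ u) (δ v) ≈ γ ℝ t
      edge-value s u v e = trans
        (+-cong (p-entry u v) (-‿cong (*-cong (sv-+ s) (m-entry u v))))
        (trans (solve 4 (λ k s x y → k :* x :- s :* (k :* y) := k :* (x :- s :* y))
                 refl k (sv s) (X u v) (Y u v))
          (trans (*-congˡ (edge {s} {u} {v} e)) (solve 1 (λ g → (:- g) :* (:- :1) := g) refl (γ ℝ t))))

-- The infimum exists and is attained.

module Attainment (em : ExcludedMiddle 0ℓ) (ℝ : CompleteOrderedField) {n : ℕ} .{{_ : NonZero n}}
  (G : SignedGraph (Fin n)) where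
  open CompleteOrderedField ℝ hiding (zero)
  open IntegerCoefficients commutativeRing
  open OrderedField ℝ
  open QuadraticForms ℝ
  open Limits em ℝ
  open SphereCorrespondence em ℝ
  open SDPFeasible

  LowerBound : Carrier → Set
  LowerBound b = ∀ t → SDPFeasible ℝ G t → b ≤ t

  -- Completeness is given for suprema, so the infimum is the supremum of the lower bounds: 1 is one
  -- of them, and the explicit feasible value bounds them all.
  infimum : ∃[ θ ] (∀ b → LowerBound b → b ≤ θ) × (∀ c → (∀ b → LowerBound b → b ≤ c) → θ ≤ c)
  infimum = supremum LowerBound (1# , λ t F → feasible⇒1≤t G F)
    (FeasiblePoint.N ℝ G , λ b b≤ → b≤ _ (FeasiblePoint.feasible ℝ G))

  θ : Carrier
  θ = proj₁ infimum

  θ-lower : LowerBound θ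
  θ-lower t F = proj₂ (proj₂ infimum) t λ b b≤ → b≤ t F

  Point : Set
  Point = ∃ (SDPFeasible ℝ G)

  -- Inhabited because otherwise θ + ε would be a lower bound exceeding the greatest one.
  nearOptimal : FilterBase Point
  nearOptimal = record
    { Near      = λ ε (t , _) → t ≤ θ + ε
    ; mono      = λ δ≤ε t≤θ+δ → ≤-trans t≤θ+δ (≤-respˡ-≈ (+-comm _ θ)
                    (≤-respʳ-≈ (+-comm _ θ) (+-monoˡ-≤ θ δ≤ε)))
    ; inhabited = λ ε 0<ε → stable λ none → 0<ε (0≤d⇒x≤y
        (x≤y⇒0≤y-x (proj₁ (proj₂ infimum) (θ + ε) λ t F → <⇒≤ λ t≤θ+ε → none ((t , F) , t≤θ+ε)))
        (solve 2 (λ x e → x :- (x :+ e) := con ℤ.0ℤ :- e) refl θ ε))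
    }

  -- Flattens a matrix, since cluster points are taken of families over a single finite index.
  entries : (Point → Matrix ℝ n) → Fin (n ℕ.* n) → Point → Carrier
  entries M k p = uncurry (M p) (remQuot {n} n k)

  -- At level 1 one has t ≤ θ + 1, so |X u v| ≤ t - 1 ≤ θ + 1 bounds all entries at once.
  XPart : ∃ (ClusterPoint nearOptimal (entries λ p → X (proj₂ p)))
  XPart = clusterPoint nearOptimal _ (θ + 1#) λ k (t , F) near →
    let u , v = remQuot {n} n k in
    within-mono (≤-trans (0≤d⇒x≤y (0≤1 ℝ) (solve 1 (λ t → :1 := t :- (t :- :1)) refl t)) near)
      (psd-entry-bound (X-sym F) (X-psd F) (X-diagonal F) u v)

  -- The Y entries cluster along the base on which X already converges, so both limits come from the
  -- same feasible points and the constraints linking X and Y survive.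
  F₁ : FilterBase Point
  F₁ = restrict nearOptimal _ (proj₁ XPart) (proj₂ XPart)

  YPart : ∃ (ClusterPoint F₁ (entries λ p → Y (proj₂ p)))
  YPart = clusterPoint F₁ _ (θ + 1#) λ k (t , F) near →
    let u , v = remQuot {n} n k in
    within-mono (proj₁ near) (psd-entry-bound (Y-sym F) (Y-psd F) (Y-diagonal F) u v)

  open Convergence (restrict F₁ _ (proj₁ YPart) (proj₂ YPart))

  X∞ Y∞ : Matrix ℝ n
  X∞ u v = proj₁ XPart (combine u v)
  Y∞ u v = proj₁ YPart (combine u v)

  fromEntries : ∀ (M : Point → Matrix ℝ n) {ε} {s : Fin (n ℕ.* n) → Carrier} {p} →
    (∀ k → Within ε (entries M k p - s k)) →
    ∀ u v → Within ε (M p u v - s (combine u v))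
  fromEntries M {ε} {s} {p} w u v =
    ≡.subst (λ (u′ , v′) → Within ε (M p u′ v′ - s (combine u v)))
      (remQuot-combine {n} u v) (w (combine u v))

  X⇝X∞ : ∀ u v → (λ p → X (proj₂ p) u v) ⇝ X∞ u v
  X⇝X∞ u v = 1# , 0≤1 ℝ , λ ε p ((_ , w) , _) →
    within-resp (sym (*-identityˡ ε)) refl (fromEntries (λ p → X (proj₂ p)) {p = p} w u v)

  Y⇝Y∞ : ∀ u v → (λ p → Y (proj₂ p) u v) ⇝ Y∞ u v
  Y⇝Y∞ u v = 1# , 0≤1 ℝ , λ ε p (_ , w) →
    within-resp (sym (*-identityˡ ε)) refl (fromEntries (λ p → Y (proj₂ p)) {p = p} w u v)

  t⇝θ : proj₁ ⇝ θ
  t⇝θ = 1# , 0≤1 ℝ , λ ε (t , F) ((t≤θ+ε , _) , _) →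
    let 0≤t-θ = x≤y⇒0≤y-x (θ-lower t F)
        0≤θ+ε-t = x≤y⇒0≤y-x t≤θ+ε
    in within-resp (sym (*-identityˡ ε)) refl
      ( ≤-respʳ-≈ (solve 3 (λ e t x → (x :+ e :- t) :+ ((t :- x) :+ (t :- x)) := e :+ (t :- x)) refl ε t θ)
          (+-nonNeg ℝ 0≤θ+ε-t (+-nonNeg ℝ 0≤t-θ 0≤t-θ))
      , ≤-respʳ-≈ (solve 3 (λ e t x → x :+ e :- t := e :- (t :- x)) refl ε t θ) 0≤θ+ε-t )

  -- For a fixed vector `c` the form is linear in the matrix entries, and nonnegativity is closed.
  psd-limit : ∀ {M : Point → Matrix ℝ n} {L} → (∀ u v → (λ p → M p u v) ⇝ L u v) →
    (∀ p → PositiveSemidefinite ℝ (M p)) → PositiveSemidefinite ℝ L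
  psd-limit {M} {L} M⇝L M-psd c = ⇝-nonNeg (λ p → M-psd p c)
    (⇝-sum λ u → ⇝-sum λ v → ⇝-cong
      (λ p → solve 3 (λ c m d → c :* d :* m := c :* m :* d) refl (c u) (M p u v) (c v))
      (solve 3 (λ c m d → c :* d :* m := c :* m :* d) refl (c u) (L u v) (c v))
      (⇝-* (c u * c v) (M⇝L u v)))

  optimal : SDPFeasible ℝ G θ
  optimal = record
    { X          = X∞
    ; Y          = Y∞
    ; X-sym      = λ u v → ⇝-unique (λ p → X-sym (proj₂ p) u v) (X⇝X∞ u v) (X⇝X∞ v u)
    ; Y-sym      = λ u v → ⇝-unique (λ p → Y-sym (proj₂ p) u v) (Y⇝Y∞ u v) (Y⇝Y∞ v u)
    ; X-psd      = psd-limit X⇝X∞ (λ p → X-psd (proj₂ p))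
    ; Y-psd      = psd-limit Y⇝Y∞ (λ p → Y-psd (proj₂ p))
    ; X-diagonal = λ v → ⇝-unique (λ p → X-diagonal (proj₂ p) v) (X⇝X∞ v v)
                           (⇝-+ t⇝θ (⇝-const (- 1#)))
    ; Y-diagonal = λ v → ⇝-unique (λ p → Y-diagonal (proj₂ p) v) (Y⇝Y∞ v v) t⇝θ
    ; edge       = λ {s} {u} {v} e → ⇝-unique (λ p → edge (proj₂ p) {s} {u} {v} e)
                     (⇝-+ (X⇝X∞ u v) (⇝-neg (⇝-* (signValue ℝ s) (Y⇝Y∞ u v)))) (⇝-const (- 1#))
    }

theorem4p1 : ExcludedMiddle 0ℓ → (ℝ : CompleteOrderedField) →
    ∀ (n : ℕ) .{{_ : NonZero n}} (G : SignedGraph (Fin n)) →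
    ∃[ θ ] (IsBalancedTheta ℝ G θ × IsSDPOptimum ℝ G θ)
theorem4p1 em ℝ n G = θ ,
  ( (λ t colourable → θ-lower t (colourable⇒feasible G colourable))
  -- Attainment makes θ itself colourable, so every lower bound of the colourable values is at most
  -- θ.
  , (λ b b≤ → b≤ θ (feasible⇒colourable G optimal)) ) ,
  (optimal , θ-lower)
  where
  open Attainment em ℝ G
  open SphereCorrespondence em ℝ
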